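{- In every sorted psi-calculus: if $P$ is a well-formed agent, then (1) $P\sigma$ is well-formed for every substitution $\sigma$; and (2) if $\Psi\rhd P\xrightarrow{\alpha}P'$ then $P'$ is well-formed.
   Context: **Names and nominal sets.** $\mathcal S$ is a set of sorts, $\mathcal S_{\mathcal N}\subseteq\mathcal S$ a countable set of name sorts; for each $s\in\mathcal S_{\mathcal N}$ there is a countably infinite set $\mathcal N_s$ of names, pairwise disjoint; $\mathcal N=\bigcup_s\mathcal N_s$. A tilde denotes a finite tuple; $\tilde x$ also denotes the set of its entries. Swappings $(a\ b)$ are only considered for names of the same sort; $(\tilde a\ \tilde b)$ is the pointwise swapping of equally long tuples. A nominal set is a set with an action of these swappings in which each element $T$ has finite support $\mathrm n(T)\subset\mathcal N$; $a\#T$ means $a\notin\mathrm n(T)$, extended to tuples by conjunction. Functions, relations and constants are equivariant if preserved by all swappings; every sort is equivariant. **Sorted psi-calculus parameters.** Nominal sets $\mathbf T$ (terms $M,N,K,L$), $\mathbf C$ (conditions $\varphi$), $\mathbf A$ (assertions $\Psi$), $\mathbf X$ (patterns $X$), and equivariant: $\leftrightarrow:\mathbf T\times\mathbf T\to\mathbf C$ (channel equivalence); $\otimes:\mathbf A\times\mathbf A\to\mathbf A$; $\mathbf 1\in\mathbf A$; $\vdash\;\subseteq\mathbf A\times\mathbf C$; $\mathrm{Match}:\mathbf T\times\mathcal N^*\times\mathbf X\to\mathcal P_{\rm fin}(\mathbf T^*)$; $\mathrm{vars}:\mathbf X\to\mathcal P_{\rm fin}(\mathcal P_{\rm fin}(\mathcal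 N))$; $\mathrm{SORT}:\mathcal N\uplus\mathbf T\uplus\mathbf X\to\mathcal S$ with $\mathrm{SORT}(a)=s$ iff $a\in\mathcal N_s$; and predicates $\underline\propto$ (can receive), $\overline\propto$ (can send), $\prec$ (can be substituted by) $\subseteq\mathcal S\times\mathcal S$, and $\mathcal S_\nu\subseteq\mathcal S_{\mathcal N}$ (restrictable sorts). Write $\Psi\simeq\Psi'$ if $\Psi,\Psi'$ entail the same conditions. Required: for each $\Psi$, $\Psi\vdash M\leftrightarrow N$ is symmetric and transitive in $M,N$; $\Psi_1\simeq\Psi_2$ implies $\Psi\otimes\Psi_1\simeq\Psi\otimes\Psi_2$; $(\mathbf A,\otimes,\mathbf 1)$ is an abelian monoid modulo $\simeq$. **Substitution and matching.** $s_1\le_{\mathbf T}s_2$ iff for all $t\in\mathcal S$: $(s_2\underline\propto t\Rightarrow s_1\underline\propto t)$, $(s_2\overline\propto t\Rightarrow s_1\overline\propto t)$, $(t\overline\propto s_2\Rightarrow t\overline\propto s_1)$. $s_1\le_{\mathbf X}s_2$ iff for all $t$: $t\underline\propto s_2\Rightarrow t\underline\propto s_1$. A substitution $\sigma=[\tilde a:=\tilde N]$ consists of distinct names and an equally long tuple of terms with $\mathrm{SORT}(a_i)\prec\mathrm{SORT}(N_i)$. Each of $\mathbf T,\mathbf C,\mathbf A$ has an equivariant substitution function with: if $\tilde b\#T,\tilde a$ then $T[\tilde a:=\tilde N]=((\tilde a\ \tilde b)\cdot T)[\tilde b:=\tilde N]$; and for terms $\mathrm{SORT}(M\sigma)\le_{\mathbf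 T}\mathrm{SORT}(M)$. $\mathbf X$ has an equivariant substitution function such that if $\tilde x\in\mathrm{vars}(X)$ and $\tilde x\#\sigma$ then $\mathrm{SORT}(X\sigma)\le_{\mathbf X}\mathrm{SORT}(X)$, $\tilde x\in\mathrm{vars}(X\sigma)$, and the same alpha-renaming law holds for $\sigma$ and $X$. If $\tilde x\in\mathrm{vars}(X)$ are distinct and $\tilde N\in\mathrm{Match}(M,\tilde x,X)$ then $[\tilde x:=\tilde N]$ is a substitution, $\mathrm n(\tilde N)\subseteq\mathrm n(M)\cup(\mathrm n(X)\setminus\tilde x)$, and $\tilde N\in\mathrm{Match}(M,\tilde y,(\tilde x\ \tilde y)\cdot X)$ for all swappings $(\tilde x\ \tilde y)$ with $\tilde y\#X$. **Agents.** Output $\overline M\,N.P$; Input $\underline M(\lambda\tilde x)X.P$ ($\tilde x$ binds in $X$ and $P$); $\mathbf{case}\ \varphi_1:P_1\,[]\cdots[]\,\varphi_n:P_n$; Restriction $(\nu a)P$ ($a$ binds in $P$); Parallel $P\mid Q$; Replication $!P$; Assertion $(\!|\Psi|\!)$. Agents are identified up to (sort-respecting) alpha-equivalence. Substitution on agents is the capture-avoiding homomorphic extension of the substitution functions of the data types. An assertion occurrence is unguarded if it is not inside an Input or Output. An agent is well-formed if in all its subterms: in $!P$ there is no unguarded assertion in $P$; in a case agent there is no unguarded assertion in any $P_i$; in $\overline M\,N.P$, $\mathrm{SORT}(M)\overline\propto\mathrm{SORT}(N)$; in $\underline M(\lambda\tilde x)X.P$, $\tilde x\in\mathrm{vars}(X)$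 is a tuple of distinct names and $\mathrm{SORT}(M)\underline\propto\mathrm{SORT}(X)$; in $(\nu a)P$, $\mathrm{SORT}(a)\in\mathcal S_\nu$. **Frames.** A frame is $(\nu\tilde b)\Psi$ with $\tilde b$ binding into $\Psi$, up to alpha-equivalence. $(\nu\tilde b_1)\Psi_1\otimes(\nu\tilde b_2)\Psi_2=(\nu\tilde b_1\tilde b_2)(\Psi_1\otimes\Psi_2)$ when $\tilde b_1\#\tilde b_2,\Psi_2$ and vice versa. $\mathcal F((\!|\Psi|\!))=\Psi$, $\mathcal F(P\mid Q)=\mathcal F(P)\otimes\mathcal F(Q)$, $\mathcal F((\nu b)P)=(\nu b)\mathcal F(P)$, and $\mathcal F$ of an input, output, case or replication is $\mathbf 1$. **Transitions.** Actions: $\overline M(\nu\tilde a)N$ with $\tilde a\subseteq\mathrm n(N)$ (bound names $\mathrm{bn}=\tilde a$), $\underline M\,N$, $\tau$ (no bound names). Bound names bind into the object and the derivative, and transitions are identified up to alpha-equivalence. $\Psi\rhd P\xrightarrow\alpha P'$, for $P$ well-formed, is defined inductively: - In: if $\Psi\vdash M\leftrightarrow K$ and $\tilde L\in\mathrm{Match}(N,\tilde y,X)$ then $\Psi\rhd\underline M(\lambda\tilde y)X.P\xrightarrow{\underline K\,N}P[\tilde y:=\tilde L]$. - Out: if $\Psi\vdash M\leftrightarrow K$ then $\Psi\rhd\overline M\,N.P\xrightarrow{\overline K\,N}P$. - Com: if $\Psi_Q\otimes\Psi\rhd P\xrightarrow{\overline M(\nu\tilde a)N}P'$, $\Psi_P\otimes\Psi\rhd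 Q\xrightarrow{\underline K\,N}Q'$, $\Psi\otimes\Psi_P\otimes\Psi_Q\vdash M\leftrightarrow K$ and $\tilde a\#Q$, then $\Psi\rhd P\mid Q\xrightarrow\tau(\nu\tilde a)(P'\mid Q')$; here $\mathcal F(P)=(\nu\tilde b_P)\Psi_P$, $\mathcal F(Q)=(\nu\tilde b_Q)\Psi_Q$, $\tilde b_P\#\Psi,\tilde b_Q,Q,M,P$ and $\tilde b_Q\#\Psi,\tilde b_P,P,K,Q$. - Par: if $\Psi_Q\otimes\Psi\rhd P\xrightarrow\alpha P'$, $\mathrm{bn}(\alpha)\#Q$, $\mathcal F(Q)=(\nu\tilde b_Q)\Psi_Q$ with $\tilde b_Q\#\Psi,P,\alpha$, then $\Psi\rhd P\mid Q\xrightarrow\alpha P'\mid Q$. - Case: if $\Psi\rhd P_i\xrightarrow\alpha P'$ and $\Psi\vdash\varphi_i$ then $\Psi\rhd\mathbf{case}\ \tilde\varphi:\tilde P\xrightarrow\alpha P'$. - Rep: if $\Psi\rhd P\mid{!P}\xrightarrow\alpha P'$ then $\Psi\rhd{!P}\xrightarrow\alpha P'$. - Scope: if $\Psi\rhd P\xrightarrow\alpha P'$ and $b\#\alpha,\Psi$ then $\Psi\rhd(\nu b)P\xrightarrow\alpha(\nu b)P'$. - Open: if $\Psi\rhd P\xrightarrow{\overline M(\nu\tilde a)N}P'$, $b\#\tilde a,\Psi,M$ and $b\in\mathrm n(N)$, then $\Psi\rhd(\nu b)P\xrightarrow{\overline M(\nu\tilde a\cup\{b\})N}P'$, where $\tilde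 a\cup\{b\}$ is $\tilde a$ with $b$ inserted anywhere. Symmetric versions of Com and Par are included. -}

module Defs where

open import Algebra.Structures using (IsCommutativeMonoid)
open import Data.Fin using (Fin)
open import Data.List using (List; []; _∷_; _++_; map; foldr; concatMap; concat; tabulate; filter)
open import Data.List.Membership.Propositional using (_∈_; _∉_)
open import Data.List.Relation.Binary.BagAndSetEquality using (_∼[_]_; set)
open import Data.List.Relation.Binary.Pointwise using (Pointwise)
open import Data.List.Relation.Binary.Subset.Propositional using (_⊆_)
open import Data.List.Relation.Unary.All using (All)
open import Data.List.Relation.Unary.Any using (Any; here; there)
open import Data.List.Relation.Unary.Unique.Propositional using (Unique)
open import Data.Nat using (ℕ; suc; _+_; _≤_)
open import Data.Nat.ListAction using (sum)
open import Data.Nat.Properties using (m≤m+n; m≤n+m; ≤-trans; 1+n≰n)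
open import Data.Product using (Σ; Σ-syntax; _×_; _,_; proj₁; proj₂)
open import Data.Product.Properties using (≡-dec)
open import Data.Vec.Functional using (Vector)
open import Function.Bundles using (_↣_; _↔_; _⇔_; Injection; Inverse)
open import Relation.Binary using (DecidableEquality; IsEquivalence)
open import Relation.Binary.PropositionalEquality using (_≡_; refl; subst)
open import Relation.Nullary using (¬_; yes; no; ¬?)
open import Relation.Nullary.Decidable using (via-injection)
import Data.List.Membership.DecPropositional as DecMembership
import Data.Nat as ℕ
import Function.Properties.Inverse as Inv

record NameSystem : Set₁ where
  field
    Sort      : Set
    -- The subset of name sorts is given by its inclusion into Sort.
    NameSort  : Set
    nameSort  : NameSort ↣ Sort
    countable : NameSort ↣ ℕ
    N         : NameSort → Set
    enumerate : ∀ s → ℕ ↔ N s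

  Name : Set
  Name = Σ NameSort N

  sortOfName : Name → Sort
  sortOfName a = Injection.to nameSort (proj₁ a)

  _≟ˢ_ : DecidableEquality NameSort
  _≟ˢ_ = via-injection countable ℕ._≟_

  _≟ⁿ_ : ∀ {s} → DecidableEquality (N s)
  _≟ⁿ_ {s} = via-injection (Inv.Inverse⇒Injection (Inv.↔-sym (enumerate s))) ℕ._≟_

  _≟_ : DecidableEquality Name
  _≟_ = ≡-dec _≟ˢ_ _≟ⁿ_

  open DecMembership _≟_ public using (_∈?_)

  infix 8 _∖_

  _∖_ : List Name → List Name → List Name
  xs ∖ ys = filter (λ x → ¬? (x ∈? ys)) xs

  -- b̃ # T, U, … is written  b̃ # (n T ++ n U ++ …).
  infix 4 _#_

  _#_ : List Name → List Name → Set
  x̃ # A = All (_∉ A) x̃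

  record Swapping : Set where
    constructor swapping
    eta-equality
    field
      {sort} : NameSort
      a b    : N sort

    left right : Name
    left  = sort , a
    right = sort , b

  open Swapping public using (left; right)

  Avoids : Swapping → List Name → Set
  Avoids π A = left π ∉ A × right π ∉ A

  swapAt : Swapping → ∀ {t} → N t → N t
  swapAt (swapping {s} a b) {t} c with s ≟ˢ t
  ... | no  _    = c
  ... | yes refl with c ≟ⁿ a | c ≟ⁿ b
  ...   | yes _ | _     = b
  ...   | no  _ | yes _ = a
  ...   | no  _ | no  _ = c

  infixr 7 _·ᴺ_ _·ˢ_ _·ᴸ_ _·*ᴺ_ _·*ᴸ_

  _·ᴺ_ : Swapping → Name → Name
  π ·ᴺ (s , c) = s , swapAt π c

  _·ˢ_ : Swapping → Swapping → Swapping
  π ·ˢ swapping a b = swapping (swapAt π a) (swapAt π b)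

  _·ᴸ_ : Swapping → List Name → List Name
  π ·ᴸ x̃ = map (π ·ᴺ_) x̃

  -- A list of swappings acts by composition, the head being applied last.
  -- The pointwise swapping (ã b̃) is the list ρ with  ã = map left ρ  and
  -- b̃ = map right ρ;  such a ρ exists exactly for equally long tuples with
  -- entries of pairwise equal sorts.
  _·*ᴺ_ : List Swapping → Name → Name
  ρ ·*ᴺ a = foldr _·ᴺ_ a ρ

  _·*ᴸ_ : List Swapping → List Name → List Name
  ρ ·*ᴸ x̃ = map (ρ ·*ᴺ_) x̃

  private
    index : Name → ℕ
    index (s , a) = Inverse.from (enumerate s) a

    index≤sum : ∀ {a} A → a ∈ A → index a ≤ sum (map index A)
    index≤sum (b ∷ A) (here refl) = m≤m+n (index b) _
    index≤sum (b ∷ A) (there a∈A) = ≤-trans (index≤sum A a∈A) (m≤n+m _ (index b))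

  freshName : ∀ s (A : List Name) → Σ[ a ∈ N s ] (s , a) ∉ A
  freshName s A = Inverse.to (enumerate s) k , λ a∈A →
      1+n≰n (subst (_≤ sum (map index A)) (Inverse.strictlyInverseʳ (enumerate s) k)
                   (index≤sum A a∈A))
    where
    k : ℕ
    k = suc (sum (map index A))

  -- For x̃ ⊆ A, the swappings freshen x̃ A move each entry of x̃ to a name
  -- outside A, keeping distinct entries distinct.
  freshen : List Name → List Name → List Swapping
  freshen []            A = []
  freshen ((s , x) ∷ x̃) A = swapping x y ∷ freshen x̃ ((s , y) ∷ A)
    where
    y : N s
    y = proj₁ (freshName s A)

record NominalSet (𝒩 : NameSystem) : Set₁ where
  open NameSystem 𝒩
  infix  4 _≈_
  infixr 7 _·_ _·*_
  field
    Carrier        : Set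
    _≈_            : Carrier → Carrier → Set
    isEquivalence  : IsEquivalence _≈_
    _·_            : Swapping → Carrier → Carrier
    ·-cong         : ∀ π {x y} → x ≈ y → π · x ≈ π · y
    -- These three laws present the group of finite sort-preserving
    -- permutations of names.
    ·-identity     : ∀ {s} (a : N s) x → swapping a a · x ≈ x
    ·-involutive   : ∀ π x → π · π · x ≈ x
    ·-conjugate    : ∀ π ρ x → π · ρ · x ≈ (π ·ˢ ρ) · π · x
    -- n x is the least finite set of names supporting x.
    n              : Carrier → List Name
    n-supports     : ∀ π x → Avoids π (n x) → π · x ≈ x
    n-least        : ∀ x A → (∀ π → Avoids π A → π · x ≈ x) → n x ⊆ A

  _·*_ : List Swapping → Carrier → Carrier
  ρ ·* x = foldr _·_ x ρ

  infix 4 _≋_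

  _≋_ : List Carrier → List Carrier → Set
  _≋_ = Pointwise _≈_

  n* : List Carrier → List Name
  n* = concatMap n

record SortedTerms (𝒩 : NameSystem) : Set₁ where
  open NameSystem 𝒩
  field
    T : NominalSet 𝒩

  module T = NominalSet T

  field
    sortOfTerm             : T.Carrier → Sort
    sortOfTerm-cong        : ∀ {M N} → M T.≈ N → sortOfTerm M ≡ sortOfTerm N
    sortOfTerm-equivariant : ∀ π M → sortOfTerm (π T.· M) ≡ sortOfTerm M
    _canReceive_           : Sort → Sort → Set
    _canSend_              : Sort → Sort → Set
    _≺_                    : Sort → Sort → Set
    Restrictable           : NameSort → Set

  infix 4 _≤ᵀ_ _≤ˣ_

  _≤ᵀ_ : Sort → Sort → Set
  s₁ ≤ᵀ s₂ = ∀ t → (s₂ canReceive t → s₁ canReceive t)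
                 × (s₂ canSend t → s₁ canSend t)
                 × (t canSend s₂ → t canSend s₁)

  _≤ˣ_ : Sort → Sort → Set
  s₁ ≤ˣ s₂ = ∀ t → t canReceive s₂ → t canReceive s₁

  record IsSubst (ã : List Name) (Ñ : List T.Carrier) : Set where
    field
      distinct : Unique ã
      sorted   : Pointwise (λ a N → sortOfName a ≺ sortOfTerm N) ã Ñ

  record Subst : Set where
    constructor [_≔_]
    eta-equality
    field
      names     : List Name
      terms     : List T.Carrier
      {isSubst} : IsSubst names terms

  open Subst public

  nˢ : Subst → List Name
  nˢ σ = names σ ++ T.n* (terms σ)

  infix 4 _≈ˢ_

  _≈ˢ_ : Subst → Subst → Set
  σ ≈ˢ τ = names σ ≡ names τ × terms σ T.≋ terms τ

  infix 4 _≈ˢ_·ˢᵘᵇ_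

  _≈ˢ_·ˢᵘᵇ_ : Subst → Swapping → Subst → Set
  τ ≈ˢ π ·ˢᵘᵇ σ = names τ ≡ π ·ᴸ names σ × terms τ T.≋ map (π T.·_) (terms σ)

record SubstitutionFunction {𝒩 : NameSystem} (𝒯 : SortedTerms 𝒩)
                            (D : NominalSet 𝒩) : Set where
  open NameSystem 𝒩
  open SortedTerms 𝒯
  open NominalSet D
  infixl 9 _[_]
  field
    _[_]             : Carrier → Subst → Carrier
    []-cong          : ∀ {x y σ τ} → x ≈ y → σ ≈ˢ τ → x [ σ ] ≈ y [ τ ]
    []-equivariant   : ∀ π x {σ τ} → τ ≈ˢ π ·ˢᵘᵇ σ → π · (x [ σ ]) ≈ (π · x) [ τ ]

  AlphaRenaming : Carrier → Subst → Set
  AlphaRenaming x σ = ∀ (ρ : List Swapping) (τ : Subst) →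
    names σ ≡ map left ρ → names τ ≡ map right ρ → terms τ ≡ terms σ →
    names τ # (n x ++ names σ) →
    x [ σ ] ≈ (ρ ·* x) [ τ ]

record SortedPsiCalculus : Set₁ where
  field
    𝒩 : NameSystem
    𝒯 : SortedTerms 𝒩

  open NameSystem 𝒩 public
  open SortedTerms 𝒯 public

  field
    C A X : NominalSet 𝒩

  module C = NominalSet C
  module A = NominalSet A
  module X = NominalSet X

  infix  4 _⊢_
  infixl 6 _⊗_
  infix  5 _↭_

  field
    _↭_                       : T.Carrier → T.Carrier → C.Carrier
    ↭-cong                    : ∀ {M M′ K K′} → M T.≈ M′ → K T.≈ K′ → (M ↭ K) C.≈ (M′ ↭ K′)
    ↭-equivariant             : ∀ π M K → π C.· (M ↭ K) C.≈ (π T.· M) ↭ (π T.· K)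

    _⊗_                       : A.Carrier → A.Carrier → A.Carrier
    ⊗-cong                    : ∀ {Ψ Ψ′ Φ Φ′} → Ψ A.≈ Ψ′ → Φ A.≈ Φ′ → Ψ ⊗ Φ A.≈ Ψ′ ⊗ Φ′
    ⊗-equivariant             : ∀ π Ψ Φ → π A.· (Ψ ⊗ Φ) A.≈ (π A.· Ψ) ⊗ (π A.· Φ)

    𝟏                         : A.Carrier
    𝟏-equivariant             : ∀ π → π A.· 𝟏 A.≈ 𝟏

    _⊢_                       : A.Carrier → C.Carrier → Set
    ⊢-resp-≈                  : ∀ {Ψ Ψ′ φ φ′} → Ψ A.≈ Ψ′ → φ C.≈ φ′ → Ψ ⊢ φ → Ψ′ ⊢ φ′
    ⊢-equivariant             : ∀ π {Ψ φ} → Ψ ⊢ φ → π A.· Ψ ⊢ π C.· φ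

    -- Finite sets are enumerated by lists and compared through the
    -- membership relations below.
    match                     : T.Carrier → List Name → X.Carrier → List (List T.Carrier)
    vars                      : X.Carrier → List (List Name)

  _∈Match[_,_,_] : List T.Carrier → T.Carrier → List Name → X.Carrier → Set
  Ñ ∈Match[ M , x̃ , Y ] = Any (Ñ T.≋_) (match M x̃ Y)

  -- The set of entries of the tuple x̃ is a member of vars Y.
  _∈vars_ : List Name → X.Carrier → Set
  x̃ ∈vars Y = Any (x̃ ∼[ set ]_) (vars Y)

  infix 4 _≃_

  _≃_ : A.Carrier → A.Carrier → Set
  Ψ ≃ Ψ′ = ∀ φ → Ψ ⊢ φ ⇔ Ψ′ ⊢ φ

  field
    match-resp-≈              : ∀ {M M′ x̃ Y Y′ Ñ} → M T.≈ M′ → Y X.≈ Y′ →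
                                Ñ ∈Match[ M , x̃ , Y ] → Ñ ∈Match[ M′ , x̃ , Y′ ]
    match-equivariant         : ∀ π {M x̃ Y Ñ} → Ñ ∈Match[ M , x̃ , Y ] →
                                map (π T.·_) Ñ ∈Match[ π T.· M , π ·ᴸ x̃ , π X.· Y ]
    vars-resp-≈               : ∀ {x̃ Y Y′} → Y X.≈ Y′ → x̃ ∈vars Y → x̃ ∈vars Y′
    vars-equivariant          : ∀ π {x̃ Y} → x̃ ∈vars Y → (π ·ᴸ x̃) ∈vars (π X.· Y)

    sortOfPattern             : X.Carrier → Sort
    sortOfPattern-cong        : ∀ {Y Y′} → Y X.≈ Y′ → sortOfPattern Y ≡ sortOfPattern Y′
    sortOfPattern-equivariant : ∀ π Y → sortOfPattern (π X.· Y) ≡ sortOfPattern Y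

    ↭-symmetric               : ∀ {Ψ M K} → Ψ ⊢ M ↭ K → Ψ ⊢ K ↭ M
    ↭-transitive              : ∀ {Ψ M K L} → Ψ ⊢ M ↭ K → Ψ ⊢ K ↭ L → Ψ ⊢ M ↭ L
    -- The congruence field of this structure is compositionality.
    ⊗-isCommutativeMonoid     : IsCommutativeMonoid _≃_ _⊗_ 𝟏

    substT                    : SubstitutionFunction 𝒯 T
    substC                    : SubstitutionFunction 𝒯 C
    substA                    : SubstitutionFunction 𝒯 A
    substX                    : SubstitutionFunction 𝒯 X

  module Tσ = SubstitutionFunction substT
  module Cσ = SubstitutionFunction substC
  module Aσ = SubstitutionFunction substA
  module Xσ = SubstitutionFunction substX

  field
    T-alpha                   : ∀ M σ → Tσ.AlphaRenaming M σ
    C-alpha                   : ∀ φ σ → Cσ.AlphaRenaming φ σ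
    A-alpha                   : ∀ Ψ σ → Aσ.AlphaRenaming Ψ σ
    T-sort                    : ∀ M σ → sortOfTerm (M Tσ.[ σ ]) ≤ᵀ sortOfTerm M

    X-sort                    : ∀ {x̃ Y} σ → x̃ ∈vars Y → x̃ # nˢ σ →
                                sortOfPattern (Y Xσ.[ σ ]) ≤ˣ sortOfPattern Y
    X-vars                    : ∀ {x̃ Y} σ → x̃ ∈vars Y → x̃ # nˢ σ → x̃ ∈vars (Y Xσ.[ σ ])
    X-alpha                   : ∀ {x̃ Y} σ → x̃ ∈vars Y → x̃ # nˢ σ → Xσ.AlphaRenaming Y σ

    match-subst               : ∀ {M x̃ Y Ñ} → x̃ ∈vars Y → Unique x̃ →
                                Ñ ∈Match[ M , x̃ , Y ] → IsSubst x̃ Ñ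
    match-names               : ∀ {M x̃ Y Ñ} → x̃ ∈vars Y → Unique x̃ →
                                Ñ ∈Match[ M , x̃ , Y ] → T.n* Ñ ⊆ T.n M ++ X.n Y ∖ x̃
    match-alpha               : ∀ {M Y Ñ} (ρ : List Swapping) → let x̃ = map left ρ; ỹ = map right ρ in
                                x̃ ∈vars Y → Unique x̃ → Ñ ∈Match[ M , x̃ , Y ] →
                                Unique ỹ → ỹ # X.n Y →
                                Ñ ∈Match[ M , ỹ , ρ X.·* Y ]

module Agents (𝒫 : SortedPsiCalculus) where
  open SortedPsiCalculus 𝒫

  infix  8 !_
  infixr 6 _∥_

  data Agent : Set where
    output : (M K : T.Carrier) (P : Agent) → Agent
    input  : (M : T.Carrier) (x̃ : List Name) (Y : X.Carrier) (P : Agent) → Agent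
    case   : ∀ {m} (φ : Vector C.Carrier m) (P : Vector Agent m) → Agent
    ν      : (a : Name) (P : Agent) → Agent
    _∥_    : (P Q : Agent) → Agent
    !_     : (P : Agent) → Agent
    ⦅_⦆    : (Ψ : A.Carrier) → Agent

  ν* : List Name → Agent → Agent
  ν* ã P = foldr ν P ã

  infixr 7 _·_ _·*_

  _·_ : Swapping → Agent → Agent
  π · output M K P  = output (π T.· M) (π T.· K) (π · P)
  π · input M x̃ Y P = input (π T.· M) (π ·ᴸ x̃) (π X.· Y) (π · P)
  π · case φ P      = case (λ i → π C.· φ i) (λ i → π · P i)
  π · ν a P         = ν (π ·ᴺ a) (π · P)
  π · (P ∥ Q)       = (π · P) ∥ (π · Q)
  π · (! P)         = ! (π · P)
  π · ⦅ Ψ ⦆         = ⦅ π A.· Ψ ⦆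

  _·*_ : List Swapping → Agent → Agent
  ρ ·* P = foldr _·_ P ρ

  -- The support of the alpha-equivalence class of an agent.
  n : Agent → List Name
  n (output M K P)  = T.n M ++ T.n K ++ n P
  n (input M x̃ Y P) = T.n M ++ (X.n Y ++ n P) ∖ x̃
  n (case φ P)      = concat (tabulate λ i → C.n (φ i) ++ n (P i))
  n (ν a P)         = n P ∖ (a ∷ [])
  n (P ∥ Q)         = n P ++ n Q
  n (! P)           = n P
  n ⦅ Ψ ⦆           = A.n Ψ

  -- Alpha-equivalence is the least congruence that allows swapping, in a
  -- binder and its scope, two names that are not free there.
  infix 4 _≡α_

  data _≡α_ : Agent → Agent → Set where
    ≡α-sym   : ∀ {P Q} → P ≡α Q → Q ≡α P
    ≡α-trans : ∀ {P Q R} → P ≡α Q → Q ≡α R → P ≡α R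
    output   : ∀ {M M′ K K′ P P′} → M T.≈ M′ → K T.≈ K′ → P ≡α P′ →
               output M K P ≡α output M′ K′ P′
    input    : ∀ {M M′ x̃ Y Y′ P P′} → M T.≈ M′ → Y X.≈ Y′ → P ≡α P′ →
               input M x̃ Y P ≡α input M′ x̃ Y′ P′
    case     : ∀ {m} {φ φ′ : Vector C.Carrier m} {P P′ : Vector Agent m} →
               (∀ i → φ i C.≈ φ′ i) → (∀ i → P i ≡α P′ i) → case φ P ≡α case φ′ P′
    ν        : ∀ {a P P′} → P ≡α P′ → ν a P ≡α ν a P′
    _∥_      : ∀ {P P′ Q Q′} → P ≡α P′ → Q ≡α Q′ → P ∥ Q ≡α P′ ∥ Q′
    !_       : ∀ {P P′} → P ≡α P′ → ! P ≡α ! P′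
    ⦅_⦆      : ∀ {Ψ Ψ′} → Ψ A.≈ Ψ′ → ⦅ Ψ ⦆ ≡α ⦅ Ψ′ ⦆
    α-input  : ∀ π {M x̃ Y P} → Avoids π ((X.n Y ++ n P) ∖ x̃) →
               input M x̃ Y P ≡α input M (π ·ᴸ x̃) (π X.· Y) (π · P)
    α-ν      : ∀ π {a P} → Avoids π (n P ∖ (a ∷ [])) →
               ν a P ≡α ν (π ·ᴺ a) (π · P)

  -- (ρ ·* P) [ σ ] by structural recursion on P.  Each binder is renamed to
  -- names fresh for σ and for its scope, and the renaming is added to ρ.
  subst-after : List Swapping → Agent → Subst → Agent
  subst-after ρ (output M K P) σ =
    output ((ρ T.·* M) Tσ.[ σ ]) ((ρ T.·* K) Tσ.[ σ ]) (subst-after ρ P σ)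
  subst-after ρ (input M x̃ Y P) σ =
    input ((ρ T.·* M) Tσ.[ σ ]) (θ ·*ᴸ ρ ·*ᴸ x̃) ((θ X.·* ρ X.·* Y) Xσ.[ σ ])
          (subst-after (θ ++ ρ) P σ)
    where
    θ : List Swapping
    θ = freshen (ρ ·*ᴸ x̃) (nˢ σ ++ ρ ·*ᴸ x̃ ++ X.n (ρ X.·* Y) ++ n (ρ ·* P))
  subst-after ρ (case φ P) σ =
    case (λ i → (ρ C.·* φ i) Cσ.[ σ ]) (λ i → subst-after ρ (P i) σ)
  subst-after ρ (ν a P) σ = ν (θ ·*ᴺ ρ ·*ᴺ a) (subst-after (θ ++ ρ) P σ)
    where
    θ : List Swapping
    θ = freshen (ρ ·*ᴺ a ∷ []) (nˢ σ ++ ρ ·*ᴺ a ∷ n (ρ ·* P))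
  subst-after ρ (P ∥ Q) σ = subst-after ρ P σ ∥ subst-after ρ Q σ
  subst-after ρ (! P)   σ = ! subst-after ρ P σ
  subst-after ρ ⦅ Ψ ⦆   σ = ⦅ (ρ A.·* Ψ) Aσ.[ σ ] ⦆

  infixl 9 _[_]

  _[_] : Agent → Subst → Agent
  P [ σ ] = subst-after [] P σ

  data UnguardedAssertion : Agent → Set where
    ⦅⦆    : ∀ {Ψ} → UnguardedAssertion ⦅ Ψ ⦆
    case  : ∀ {m} {φ : Vector C.Carrier m} {P : Vector Agent m} i →
            UnguardedAssertion (P i) → UnguardedAssertion (case φ P)
    ν     : ∀ {a P} → UnguardedAssertion P → UnguardedAssertion (ν a P)
    ∥-left  : ∀ {P Q} → UnguardedAssertion P → UnguardedAssertion (P ∥ Q)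
    ∥-right : ∀ {P Q} → UnguardedAssertion Q → UnguardedAssertion (P ∥ Q)
    !_    : ∀ {P} → UnguardedAssertion P → UnguardedAssertion (! P)

  data WellFormed : Agent → Set where
    output : ∀ {M K P} → sortOfTerm M canSend sortOfTerm K →
             WellFormed P → WellFormed (output M K P)
    input  : ∀ {M x̃ Y P} → x̃ ∈vars Y → Unique x̃ →
             sortOfTerm M canReceive sortOfPattern Y →
             WellFormed P → WellFormed (input M x̃ Y P)
    case   : ∀ {m} {φ : Vector C.Carrier m} {P : Vector Agent m} →
             (∀ i → ¬ UnguardedAssertion (P i)) →
             (∀ i → WellFormed (P i)) → WellFormed (case φ P)
    ν      : ∀ {a P} → Restrictable (proj₁ a) → WellFormed P → WellFormed (ν a P)
    _∥_    : ∀ {P Q} → WellFormed P → WellFormed Q → WellFormed (P ∥ Q)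
    repl   : ∀ {P} → ¬ UnguardedAssertion P → WellFormed P → WellFormed (! P)
    ⦅_⦆    : ∀ Ψ → WellFormed ⦅ Ψ ⦆

  record Frame : Set where
    constructor ⟨ν_⟩_
    field
      binders   : List Name
      assertion : A.Carrier

  infix 4 _≡ᶠ_

  -- Alpha-equivalence of frames, ⟨ν b₁ … bₖ ⟩ Ψ being nested binding.
  data _≡ᶠ_ : Frame → Frame → Set where
    ≡ᶠ-sym   : ∀ {F G} → F ≡ᶠ G → G ≡ᶠ F
    ≡ᶠ-trans : ∀ {F G H} → F ≡ᶠ G → G ≡ᶠ H → F ≡ᶠ H
    ≈⇒≡ᶠ     : ∀ {Ψ Ψ′} → Ψ A.≈ Ψ′ → ⟨ν [] ⟩ Ψ ≡ᶠ ⟨ν [] ⟩ Ψ′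
    ν        : ∀ {b b̃ b̃′ Ψ Ψ′} → ⟨ν b̃ ⟩ Ψ ≡ᶠ ⟨ν b̃′ ⟩ Ψ′ →
               ⟨ν b ∷ b̃ ⟩ Ψ ≡ᶠ ⟨ν b ∷ b̃′ ⟩ Ψ′
    α-ν      : ∀ π {b̃ Ψ} → Avoids π (A.n Ψ ∖ b̃) →
               ⟨ν b̃ ⟩ Ψ ≡ᶠ ⟨ν π ·ᴸ b̃ ⟩ (π A.· Ψ)

  -- Both tuples of binders are first renamed apart.
  _⊗ᶠ_ : Frame → Frame → Frame
  (⟨ν b̃₁ ⟩ Ψ₁) ⊗ᶠ (⟨ν b̃₂ ⟩ Ψ₂) = ⟨ν c̃₁ ++ c̃₂ ⟩ ((θ₁ A.·* Ψ₁) ⊗ (θ₂ A.·* Ψ₂))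
    where
    avoid : List Name
    avoid = b̃₁ ++ A.n Ψ₁ ++ b̃₂ ++ A.n Ψ₂
    θ₁ : List Swapping
    θ₁ = freshen b̃₁ avoid
    c̃₁ : List Name
    c̃₁ = θ₁ ·*ᴸ b̃₁
    θ₂ : List Swapping
    θ₂ = freshen b̃₂ (c̃₁ ++ avoid)
    c̃₂ : List Name
    c̃₂ = θ₂ ·*ᴸ b̃₂

  ℱ : Agent → Frame
  ℱ (output M K P)  = ⟨ν [] ⟩ 𝟏
  ℱ (input M x̃ Y P) = ⟨ν [] ⟩ 𝟏
  ℱ (case φ P)      = ⟨ν [] ⟩ 𝟏
  ℱ (ν b P)         = ⟨ν b ∷ Frame.binders (ℱ P) ⟩ Frame.assertion (ℱ P)
  ℱ (P ∥ Q)         = ℱ P ⊗ᶠ ℱ Q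
  ℱ (! P)           = ⟨ν [] ⟩ 𝟏
  ℱ ⦅ Ψ ⦆           = ⟨ν [] ⟩ Ψ

  -- The inclusion ã ⊆ n(K) in M̅(νã)K holds in every derivable transition.
  data Action : Set where
    out : (M : T.Carrier) (ã : List Name) (K : T.Carrier) → Action
    inp : (M K : T.Carrier) → Action
    τ   : Action

  bn : Action → List Name
  bn (out M ã K) = ã
  bn (inp M K)   = []
  bn τ           = []

  nᵃ : Action → List Name
  nᵃ (out M ã K) = T.n M ++ ã ++ T.n K
  nᵃ (inp M K)   = T.n M ++ T.n K
  nᵃ τ           = []

  infix 4 _≈ᵃ_

  data _≈ᵃ_ : Action → Action → Set where
    out : ∀ {M M′ ã K K′} → M T.≈ M′ → K T.≈ K′ → out M ã K ≈ᵃ out M′ ã K′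
    inp : ∀ {M M′ K K′} → M T.≈ M′ → K T.≈ K′ → inp M K ≈ᵃ inp M′ K′
    τ   : τ ≈ᵃ τ

  infix 3 _▷_—[_]→_

  data _▷_—[_]→_ : A.Carrier → Agent → Action → Agent → Set where

    -- Only well-formed agents have transitions; here this also makes
    -- [ ỹ ≔ L̃ ] a substitution.
    In : ∀ {Ψ M K N ỹ L̃ Y P}
       → (ỹ∈vars : ỹ ∈vars Y) (unique : Unique ỹ)
       → sortOfTerm M canReceive sortOfPattern Y
       → WellFormed P
       → Ψ ⊢ M ↭ K
       → (m : L̃ ∈Match[ N , ỹ , Y ])
       → Ψ ▷ input M ỹ Y P —[ inp K N ]→ P [ [ ỹ ≔ L̃ ] {match-subst ỹ∈vars unique m} ]

    Out : ∀ {Ψ M K N P}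
        → Ψ ⊢ M ↭ K
        → Ψ ▷ output M N P —[ out K [] N ]→ P

    Com : ∀ {Ψ P Q P′ Q′ M K N ã b̃P ΨP b̃Q ΨQ}
        → ℱ P ≡ᶠ ⟨ν b̃P ⟩ ΨP
        → ℱ Q ≡ᶠ ⟨ν b̃Q ⟩ ΨQ
        → b̃P # A.n Ψ ++ b̃Q ++ n Q ++ T.n M ++ n P
        → b̃Q # A.n Ψ ++ b̃P ++ n P ++ T.n K ++ n Q
        → ΨQ ⊗ Ψ ▷ P —[ out M ã N ]→ P′
        → ΨP ⊗ Ψ ▷ Q —[ inp K N ]→ Q′
        → Ψ ⊗ ΨP ⊗ ΨQ ⊢ M ↭ K
        → ã # n Q
        → Ψ ▷ P ∥ Q —[ τ ]→ ν* ã (P′ ∥ Q′)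

    Com-sym : ∀ {Ψ P Q P′ Q′ M K N ã b̃P ΨP b̃Q ΨQ}
        → ℱ P ≡ᶠ ⟨ν b̃P ⟩ ΨP
        → ℱ Q ≡ᶠ ⟨ν b̃Q ⟩ ΨQ
        → b̃P # A.n Ψ ++ b̃Q ++ n Q ++ T.n K ++ n P
        → b̃Q # A.n Ψ ++ b̃P ++ n P ++ T.n M ++ n Q
        → ΨQ ⊗ Ψ ▷ P —[ inp K N ]→ P′
        → ΨP ⊗ Ψ ▷ Q —[ out M ã N ]→ Q′
        → Ψ ⊗ ΨP ⊗ ΨQ ⊢ M ↭ K
        → ã # n P
        → Ψ ▷ P ∥ Q —[ τ ]→ ν* ã (P′ ∥ Q′)

    Par : ∀ {Ψ P Q P′ α b̃Q ΨQ}
        → ℱ Q ≡ᶠ ⟨ν b̃Q ⟩ ΨQ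
        → b̃Q # A.n Ψ ++ n P ++ nᵃ α
        → ΨQ ⊗ Ψ ▷ P —[ α ]→ P′
        → bn α # n Q
        → Ψ ▷ P ∥ Q —[ α ]→ P′ ∥ Q

    Par-sym : ∀ {Ψ P Q Q′ α b̃P ΨP}
        → ℱ P ≡ᶠ ⟨ν b̃P ⟩ ΨP
        → b̃P # A.n Ψ ++ n Q ++ nᵃ α
        → ΨP ⊗ Ψ ▷ Q —[ α ]→ Q′
        → bn α # n P
        → Ψ ▷ P ∥ Q —[ α ]→ P ∥ Q′

    Case : ∀ {Ψ m} {φ : Vector C.Carrier m} {P : Vector Agent m} {P′ α} (i : Fin m)
         → Ψ ▷ P i —[ α ]→ P′
         → Ψ ⊢ φ i
         → Ψ ▷ case φ P —[ α ]→ P′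

    Rep : ∀ {Ψ P P′ α}
        → Ψ ▷ P ∥ ! P —[ α ]→ P′
        → Ψ ▷ ! P —[ α ]→ P′

    Scope : ∀ {Ψ b P P′ α}
          → Ψ ▷ P —[ α ]→ P′
          → b ∉ nᵃ α ++ A.n Ψ
          → Ψ ▷ ν b P —[ α ]→ ν b P′

    Open : ∀ {Ψ b P P′ M N} (ã₁ ã₂ : List Name)
         → Ψ ▷ P —[ out M (ã₁ ++ ã₂) N ]→ P′
         → b ∉ (ã₁ ++ ã₂) ++ A.n Ψ ++ T.n M
         → b ∈ T.n N
         → Ψ ▷ ν b P —[ out M (ã₁ ++ b ∷ ã₂) N ]→ P′

    -- The bound names of an output bind into its object and the derivative.
    α-bn : ∀ π {Ψ P P′ M ã N}
         → Avoids π ((T.n N ++ n P′) ∖ ã)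
         → Ψ ▷ P —[ out M ã N ]→ P′
         → Ψ ▷ P —[ out M (π ·ᴸ ã) (π T.· N) ]→ π · P′

    -- Everything is identified up to equality of data and alpha-equivalence.
    resp : ∀ {Ψ Ψ′ P Q α β P′ Q′}
         → Ψ A.≈ Ψ′ → P ≡α Q → α ≈ᵃ β → P′ ≡α Q′
         → Ψ ▷ P —[ α ]→ P′
         → Ψ′ ▷ Q —[ β ]→ Q′

{-# OPTIONS --safe #-}
module Submission where

-- Every premise of well-formedness concerns sorts, the tuples in vars, or the
-- absence of unguarded assertions, and each is stable under the operations
-- that act on agents.
--
-- Swappings preserve sorts and act equivariantly on vars, so well-formedness
-- is preserved and reflected by swappings (·-wellFormed, ·-wellFormed⁻¹), and
-- hence invariant under alpha-equivalence (≡α-wellFormed).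
--
-- A substitution never creates an unguarded assertion. It replaces the sort of
-- a term by one that is smaller for ≤ᵀ, hence at least as capable as subject
-- and as object. The binders of an input are first renamed to names fresh for
-- the substitution (freshen-avoids), so that the laws X-sort and X-vars apply:
-- the renamed tuple is still in vars of the pattern, and the sort of the
-- pattern is smaller for ≤ˣ. The induction is on well-formedness, for all the
-- renamings that the capture-avoiding substitution accumulates
-- (subst-after-wellFormed).
--
-- For transitions, the induction must also record that the bound names of the
-- action have restrictable sorts (derivative-wellFormed): Open moves a
-- restriction into the label, and Com puts it back around the derivative.

open import Defs
open import Data.List using (List; []; _∷_; _++_; map)
open import Data.List.Membership.Propositional using (_∈_; _∉_)
open import Data.List.Membership.Propositional.Properties using (∈-++⁺ˡ; ∈-++⁺ʳ)
open import Data.List.Properties using (map-∘; map-cong; map-id)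
open import Data.List.Relation.Binary.Subset.Propositional using (_⊆_)
open import Data.List.Relation.Unary.All as All using (All; []; _∷_)
open import Data.List.Relation.Unary.All.Properties as All using (++⁺; ++⁻)
open import Data.List.Relation.Unary.AllPairs using ([]; _∷_)
open import Data.List.Relation.Unary.Any using (here; there)
open import Data.List.Relation.Unary.Unique.Propositional using (Unique)
import Data.List.Relation.Unary.Unique.Propositional.Properties as Unique
open import Data.Product using (_×_; _,_; proj₁; proj₂)
open import Function using (_∘_; id)
open import Function.Definitions using (Injective)
open import Relation.Binary using (IsEquivalence)
open import Relation.Binary.PropositionalEquality
  using (_≡_; _≢_; refl; sym; trans; cong; subst; subst₂; module ≡-Reasoning)
open import Relation.Nullary using (yes; no; contradiction)

-- Swappings of names

module Names (𝒩 : NameSystem) where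
  open NameSystem 𝒩

  swapAt-involutive : ∀ π {t} (c : N t) → swapAt π (swapAt π c) ≡ c
  swapAt-involutive (swapping {s} a b) {t} c with s ≟ˢ t
  ... | no _ = refl
  ... | yes refl with c ≟ⁿ a | c ≟ⁿ b
  ...   | yes c≡a | _ with b ≟ⁿ a | b ≟ⁿ b
  ...     | yes b≡a | _       = trans b≡a (sym c≡a)
  ...     | no _    | yes _   = sym c≡a
  ...     | no _    | no  b≢b = contradiction refl b≢b
  swapAt-involutive (swapping a b) c | yes refl | no _ | yes c≡b with a ≟ⁿ a
  ...     | yes _   = sym c≡b
  ...     | no  a≢a = contradiction refl a≢a
  swapAt-involutive (swapping a b) c | yes refl | no c≢a | no c≢b
    with c ≟ⁿ a | c ≟ⁿ b
  ...     | yes c≡a | _       = contradiction c≡a c≢a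
  ...     | no _    | yes c≡b = contradiction c≡b c≢b
  ...     | no _    | no _    = refl

  ·ᴺ-involutive : ∀ π a → π ·ᴺ π ·ᴺ a ≡ a
  ·ᴺ-involutive π (s , c) = cong (s ,_) (swapAt-involutive π c)

  ·ᴺ-left : ∀ π → π ·ᴺ left π ≡ right π
  ·ᴺ-left (swapping {s} a b) with s ≟ˢ s
  ... | no s≢s   = contradiction refl s≢s
  ... | yes refl with a ≟ⁿ a
  ...   | yes _   = refl
  ...   | no  a≢a = contradiction refl a≢a

  ·ᴺ-fixes : ∀ π {c} → c ≢ left π → c ≢ right π → π ·ᴺ c ≡ c
  ·ᴺ-fixes (swapping {s} a b) {t , c} c≢a c≢b with s ≟ˢ t
  ... | no _     = refl
  ... | yes refl with c ≟ⁿ a | c ≟ⁿ b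
  ...   | yes refl | _        = contradiction refl c≢a
  ...   | no _     | yes refl = contradiction refl c≢b
  ...   | no _     | no _     = refl

  ·ᴺ-injective : ∀ π → Injective _≡_ _≡_ (π ·ᴺ_)
  ·ᴺ-injective π {a} {b} πa≡πb = begin
    a             ≡⟨ ·ᴺ-involutive π a ⟨
    π ·ᴺ π ·ᴺ a   ≡⟨ cong (π ·ᴺ_) πa≡πb ⟩
    π ·ᴺ π ·ᴺ b   ≡⟨ ·ᴺ-involutive π b ⟩
    b             ∎
    where open ≡-Reasoning

  ·*ᴺ-injective : ∀ ρ → Injective _≡_ _≡_ (ρ ·*ᴺ_)
  ·*ᴺ-injective []      = id
  ·*ᴺ-injective (π ∷ ρ) = ·*ᴺ-injective ρ ∘ ·ᴺ-injective π

  ·ᴸ-involutive : ∀ π x̃ → π ·ᴸ π ·ᴸ x̃ ≡ x̃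
  ·ᴸ-involutive π x̃ = begin
    π ·ᴸ π ·ᴸ x̃                ≡⟨ map-∘ x̃ ⟨
    map (λ a → π ·ᴺ π ·ᴺ a) x̃  ≡⟨ map-cong (·ᴺ-involutive π) x̃ ⟩
    map id x̃                   ≡⟨ map-id x̃ ⟩
    x̃                          ∎
    where open ≡-Reasoning

  ·ᴸ-unique : ∀ π {x̃} → Unique x̃ → Unique (π ·ᴸ x̃)
  ·ᴸ-unique π = Unique.map⁺ (·ᴺ-injective π)

  ·ᴸ-unique⁻¹ : ∀ π {x̃} → Unique (π ·ᴸ x̃) → Unique x̃
  ·ᴸ-unique⁻¹ π {x̃} u = subst Unique (·ᴸ-involutive π x̃) (·ᴸ-unique π u)

  ·*ᴸ-unique : ∀ ρ {x̃} → Unique x̃ → Unique (ρ ·*ᴸ x̃)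
  ·*ᴸ-unique ρ = Unique.map⁺ (·*ᴺ-injective ρ)

  ·*ᴺ-sort : ∀ ρ a → proj₁ (ρ ·*ᴺ a) ≡ proj₁ a
  ·*ᴺ-sort []      a = refl
  ·*ᴺ-sort (π ∷ ρ) a = ·*ᴺ-sort ρ a

  freshen-fixes : ∀ x̃ {A z} → z ∈ A → z ∉ x̃ → freshen x̃ A ·*ᴺ z ≡ z
  freshen-fixes []            z∈A z∉x̃ = refl
  freshen-fixes ((s , x) ∷ x̃) {A} {z} z∈A z∉x̃ = begin
    π ·ᴺ θ ·*ᴺ z  ≡⟨ cong (π ·ᴺ_) (freshen-fixes x̃ (there z∈A) (z∉x̃ ∘ there)) ⟩
    π ·ᴺ z        ≡⟨ ·ᴺ-fixes π (z∉x̃ ∘ here) (λ { refl → y∉A z∈A }) ⟩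
    z             ∎
    where
    open ≡-Reasoning
    y : N s
    y = proj₁ (freshName s A)
    y∉A : (s , y) ∉ A
    y∉A = proj₂ (freshName s A)
    π : Swapping
    π = swapping x y
    θ : List Swapping
    θ = freshen x̃ ((s , y) ∷ A)

  -- The swapping for the head is applied last. Distinctness ensures that it
  -- still finds its entry x unmoved, and the inclusion in A that it leaves the
  -- fresh names already chosen for the tail unchanged.
  freshen-avoids : ∀ x̃ {A} → Unique x̃ → x̃ ⊆ A → freshen x̃ A ·*ᴸ x̃ # A
  freshen-avoids []            u         x̃⊆A = []
  freshen-avoids ((s , x) ∷ x̃) {A} (x≢x̃ ∷ u) x̃⊆A =
    subst (_∉ A) (sym head-moved) y∉A ∷
    All.map⁺ (All.map tail-avoids (All.map⁻ (freshen-avoids x̃ u (there ∘ x̃⊆A ∘ there))))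
    where
    y : N s
    y = proj₁ (freshName s A)
    y∉A : (s , y) ∉ A
    y∉A = proj₂ (freshName s A)
    π : Swapping
    π = swapping x y
    θ : List Swapping
    θ = freshen x̃ ((s , y) ∷ A)
    -- x is in A and not in x̃, so the swappings for the tail leave it alone.
    head-moved : π ·ᴺ θ ·*ᴺ (s , x) ≡ (s , y)
    head-moved = trans
      (cong (π ·ᴺ_)
        (freshen-fixes x̃ (there (x̃⊆A (here refl))) (λ x∈x̃ → All.lookup x≢x̃ x∈x̃ refl)))
      (·ᴺ-left π)
    -- A name outside A and different from y is fixed by π, since x is in A.
    tail-avoids : ∀ {z} → θ ·*ᴺ z ∉ (s , y) ∷ A → π ·ᴺ θ ·*ᴺ z ∉ A
    tail-avoids z∉yA = subst (_∉ A)
      (sym (·ᴺ-fixes π (λ z≡x → z∉yA (there (subst (_∈ A) (sym z≡x) (x̃⊆A (here refl)))))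
                       (z∉yA ∘ here)))
      (z∉yA ∘ there)

module Preservation (𝒫 : SortedPsiCalculus) where
  open SortedPsiCalculus 𝒫
  open Agents 𝒫
  open Names 𝒩

  -- Sorts and pattern variables under swappings

  ·*-sortOfTerm : ∀ ρ M → sortOfTerm (ρ T.·* M) ≡ sortOfTerm M
  ·*-sortOfTerm []      M = refl
  ·*-sortOfTerm (π ∷ ρ) M = trans (sortOfTerm-equivariant π _) (·*-sortOfTerm ρ M)

  ·*-sortOfPattern : ∀ ρ Y → sortOfPattern (ρ X.·* Y) ≡ sortOfPattern Y
  ·*-sortOfPattern []      Y = refl
  ·*-sortOfPattern (π ∷ ρ) Y = trans (sortOfPattern-equivariant π _) (·*-sortOfPattern ρ Y)

  ·-vars⁻¹ : ∀ π {x̃ Y} → (π ·ᴸ x̃) ∈vars (π X.· Y) → x̃ ∈vars Y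
  ·-vars⁻¹ π {x̃} {Y} v =
    subst (_∈vars Y) (·ᴸ-involutive π x̃)
      (vars-resp-≈ (X.·-involutive π Y) (vars-equivariant π v))

  ·*-vars : ∀ ρ {x̃ Y} → x̃ ∈vars Y → (ρ ·*ᴸ x̃) ∈vars (ρ X.·* Y)
  ·*-vars []      {x̃} {Y} v = subst (_∈vars Y) (sym (map-id x̃)) v
  ·*-vars (π ∷ ρ) {x̃} {Y} v =
    subst (_∈vars (π X.· ρ X.·* Y)) (sym (map-∘ x̃)) (vars-equivariant π (·*-vars ρ v))

  -- Swappings and alpha-equivalence

  ·-unguarded : ∀ π {P} → UnguardedAssertion P → UnguardedAssertion (π · P)
  ·-unguarded π ⦅⦆          = ⦅⦆
  ·-unguarded π (case i u)  = case i (·-unguarded π u)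
  ·-unguarded π (ν u)       = ν (·-unguarded π u)
  ·-unguarded π (∥-left u)  = ∥-left (·-unguarded π u)
  ·-unguarded π (∥-right u) = ∥-right (·-unguarded π u)
  ·-unguarded π (! u)       = ! ·-unguarded π u

  ·-unguarded⁻¹ : ∀ π P → UnguardedAssertion (π · P) → UnguardedAssertion P
  ·-unguarded⁻¹ π (case φ P) (case i u)  = case i (·-unguarded⁻¹ π (P i) u)
  ·-unguarded⁻¹ π (ν a P)    (ν u)       = ν (·-unguarded⁻¹ π P u)
  ·-unguarded⁻¹ π (P ∥ Q)    (∥-left u)  = ∥-left (·-unguarded⁻¹ π P u)
  ·-unguarded⁻¹ π (P ∥ Q)    (∥-right u) = ∥-right (·-unguarded⁻¹ π Q u)
  ·-unguarded⁻¹ π (! P)      (! u)       = ! ·-unguarded⁻¹ π P u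
  ·-unguarded⁻¹ π ⦅ Ψ ⦆      ⦅⦆          = ⦅⦆

  ·-wellFormed : ∀ π {P} → WellFormed P → WellFormed (π · P)
  ·-wellFormed π (output {M} {K} s w) =
    output (subst₂ _canSend_ (sym (sortOfTerm-equivariant π M))
                             (sym (sortOfTerm-equivariant π K)) s)
           (·-wellFormed π w)
  ·-wellFormed π (input {M} {_} {Y} v u r w) =
    input (vars-equivariant π v) (·ᴸ-unique π u)
          (subst₂ _canReceive_ (sym (sortOfTerm-equivariant π M))
                               (sym (sortOfPattern-equivariant π Y)) r)
          (·-wellFormed π w)
  ·-wellFormed π (case {P = P} g w) =
    case (λ i → g i ∘ ·-unguarded⁻¹ π (P i)) (λ i → ·-wellFormed π (w i))
  ·-wellFormed π (ν s w)            = ν s (·-wellFormed π w)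
  ·-wellFormed π (w ∥ w′)           = ·-wellFormed π w ∥ ·-wellFormed π w′
  ·-wellFormed π (repl {P} g w)     = repl (g ∘ ·-unguarded⁻¹ π P) (·-wellFormed π w)
  ·-wellFormed π ⦅ Ψ ⦆              = ⦅ _ ⦆

  ·-wellFormed⁻¹ : ∀ π P → WellFormed (π · P) → WellFormed P
  ·-wellFormed⁻¹ π (output M K P) (output s w) =
    output (subst₂ _canSend_ (sortOfTerm-equivariant π M) (sortOfTerm-equivariant π K) s)
           (·-wellFormed⁻¹ π P w)
  ·-wellFormed⁻¹ π (input M x̃ Y P) (input v u r w) =
    input (·-vars⁻¹ π v) (·ᴸ-unique⁻¹ π u)
          (subst₂ _canReceive_ (sortOfTerm-equivariant π M) (sortOfPattern-equivariant π Y) r)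
          (·-wellFormed⁻¹ π P w)
  ·-wellFormed⁻¹ π (case φ P) (case g w) =
    case (λ i → g i ∘ ·-unguarded π) (λ i → ·-wellFormed⁻¹ π (P i) (w i))
  ·-wellFormed⁻¹ π (ν a P) (ν s w)    = ν s (·-wellFormed⁻¹ π P w)
  ·-wellFormed⁻¹ π (P ∥ Q) (w ∥ w′)   = ·-wellFormed⁻¹ π P w ∥ ·-wellFormed⁻¹ π Q w′
  ·-wellFormed⁻¹ π (! P)   (repl g w) = repl (g ∘ ·-unguarded π) (·-wellFormed⁻¹ π P w)
  ·-wellFormed⁻¹ π ⦅ Ψ ⦆   w          = ⦅ Ψ ⦆

  -- The symmetry rule forces each invariance under alpha-equivalence to be
  -- proved in both directions at once.
  ≡α-unguarded   : ∀ {P Q} → P ≡α Q → UnguardedAssertion P → UnguardedAssertion Q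
  ≡α-unguarded⁻¹ : ∀ {P Q} → P ≡α Q → UnguardedAssertion Q → UnguardedAssertion P

  ≡α-unguarded (≡α-sym e)      u           = ≡α-unguarded⁻¹ e u
  ≡α-unguarded (≡α-trans e e′) u           = ≡α-unguarded e′ (≡α-unguarded e u)
  ≡α-unguarded (case _ e)      (case i u)  = case i (≡α-unguarded (e i) u)
  ≡α-unguarded (ν e)           (ν u)       = ν (≡α-unguarded e u)
  ≡α-unguarded (e ∥ _)         (∥-left u)  = ∥-left (≡α-unguarded e u)
  ≡α-unguarded (_ ∥ e)         (∥-right u) = ∥-right (≡α-unguarded e u)
  ≡α-unguarded (! e)           (! u)       = ! ≡α-unguarded e u
  ≡α-unguarded ⦅ _ ⦆           ⦅⦆          = ⦅⦆
  ≡α-unguarded (α-ν π _)       (ν u)       = ν (·-unguarded π u)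

  ≡α-unguarded⁻¹ (≡α-sym e)      u           = ≡α-unguarded e u
  ≡α-unguarded⁻¹ (≡α-trans e e′) u           = ≡α-unguarded⁻¹ e (≡α-unguarded⁻¹ e′ u)
  ≡α-unguarded⁻¹ (case _ e)      (case i u)  = case i (≡α-unguarded⁻¹ (e i) u)
  ≡α-unguarded⁻¹ (ν e)           (ν u)       = ν (≡α-unguarded⁻¹ e u)
  ≡α-unguarded⁻¹ (e ∥ _)         (∥-left u)  = ∥-left (≡α-unguarded⁻¹ e u)
  ≡α-unguarded⁻¹ (_ ∥ e)         (∥-right u) = ∥-right (≡α-unguarded⁻¹ e u)
  ≡α-unguarded⁻¹ (! e)           (! u)       = ! ≡α-unguarded⁻¹ e u
  ≡α-unguarded⁻¹ ⦅ _ ⦆           ⦅⦆          = ⦅⦆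
  ≡α-unguarded⁻¹ (α-ν π {P = P} _) (ν u)     = ν (·-unguarded⁻¹ π P u)

  ≡α-wellFormed   : ∀ {P Q} → P ≡α Q → WellFormed P → WellFormed Q
  ≡α-wellFormed⁻¹ : ∀ {P Q} → P ≡α Q → WellFormed Q → WellFormed P

  ≡α-wellFormed (≡α-sym e)      w = ≡α-wellFormed⁻¹ e w
  ≡α-wellFormed (≡α-trans e e′) w = ≡α-wellFormed e′ (≡α-wellFormed e w)
  ≡α-wellFormed (output eM eK e) (output s w) =
    output (subst₂ _canSend_ (sortOfTerm-cong eM) (sortOfTerm-cong eK) s) (≡α-wellFormed e w)
  ≡α-wellFormed (input eM eY e) (input v u r w) =
    input (vars-resp-≈ eY v) u
          (subst₂ _canReceive_ (sortOfTerm-cong eM) (sortOfPattern-cong eY) r)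
          (≡α-wellFormed e w)
  ≡α-wellFormed (case _ e) (case g w) =
    case (λ i → g i ∘ ≡α-unguarded⁻¹ (e i)) (λ i → ≡α-wellFormed (e i) (w i))
  ≡α-wellFormed (ν e)    (ν s w)    = ν s (≡α-wellFormed e w)
  ≡α-wellFormed (e ∥ e′) (w ∥ w′)   = ≡α-wellFormed e w ∥ ≡α-wellFormed e′ w′
  ≡α-wellFormed (! e)    (repl g w) = repl (g ∘ ≡α-unguarded⁻¹ e) (≡α-wellFormed e w)
  ≡α-wellFormed ⦅ _ ⦆    w          = ⦅ _ ⦆
  ≡α-wellFormed (α-input π {Y = Y} _) (input v u r w) =
    input (vars-equivariant π v) (·ᴸ-unique π u)
          (subst (_ canReceive_) (sym (sortOfPattern-equivariant π Y)) r)
          (·-wellFormed π w)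
  ≡α-wellFormed (α-ν π _) (ν s w) = ν s (·-wellFormed π w)

  ≡α-wellFormed⁻¹ (≡α-sym e)      w = ≡α-wellFormed e w
  ≡α-wellFormed⁻¹ (≡α-trans e e′) w = ≡α-wellFormed⁻¹ e (≡α-wellFormed⁻¹ e′ w)
  ≡α-wellFormed⁻¹ (output eM eK e) (output s w) =
    output (subst₂ _canSend_ (sym (sortOfTerm-cong eM)) (sym (sortOfTerm-cong eK)) s)
           (≡α-wellFormed⁻¹ e w)
  ≡α-wellFormed⁻¹ (input eM eY e) (input v u r w) =
    input (vars-resp-≈ (IsEquivalence.sym X.isEquivalence eY) v) u
          (subst₂ _canReceive_ (sym (sortOfTerm-cong eM)) (sym (sortOfPattern-cong eY)) r)
          (≡α-wellFormed⁻¹ e w)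
  ≡α-wellFormed⁻¹ (case _ e) (case g w) =
    case (λ i → g i ∘ ≡α-unguarded (e i)) (λ i → ≡α-wellFormed⁻¹ (e i) (w i))
  ≡α-wellFormed⁻¹ (ν e)    (ν s w)    = ν s (≡α-wellFormed⁻¹ e w)
  ≡α-wellFormed⁻¹ (e ∥ e′) (w ∥ w′)   = ≡α-wellFormed⁻¹ e w ∥ ≡α-wellFormed⁻¹ e′ w′
  ≡α-wellFormed⁻¹ (! e)    (repl g w) = repl (g ∘ ≡α-unguarded e) (≡α-wellFormed⁻¹ e w)
  ≡α-wellFormed⁻¹ ⦅ _ ⦆    w          = ⦅ _ ⦆
  ≡α-wellFormed⁻¹ (α-input π {Y = Y} {P = P} _) (input v u r w) =
    input (·-vars⁻¹ π v) (·ᴸ-unique⁻¹ π u)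
          (subst (_ canReceive_) (sortOfPattern-equivariant π Y) r)
          (·-wellFormed⁻¹ π P w)
  ≡α-wellFormed⁻¹ (α-ν π {P = P} _) (ν s w) = ν s (·-wellFormed⁻¹ π P w)

  -- Substitution

  -- Term sorts are invariant under renaming, so T-sort also bounds the sort
  -- obtained by renaming before substituting.
  renamed-term-sort : ∀ ρ M σ → sortOfTerm ((ρ T.·* M) Tσ.[ σ ]) ≤ᵀ sortOfTerm M
  renamed-term-sort ρ M σ =
    subst (sortOfTerm ((ρ T.·* M) Tσ.[ σ ]) ≤ᵀ_) (·*-sortOfTerm ρ M) (T-sort (ρ T.·* M) σ)

  subst-after-unguarded : ∀ ρ P σ → UnguardedAssertion (subst-after ρ P σ) →
                          UnguardedAssertion P
  subst-after-unguarded ρ (case φ P) σ (case i u)  = case i (subst-after-unguarded ρ (P i) σ u)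
  subst-after-unguarded ρ (ν a P)    σ (ν u)       = ν (subst-after-unguarded _ P σ u)
  subst-after-unguarded ρ (P ∥ Q)    σ (∥-left u)  = ∥-left (subst-after-unguarded ρ P σ u)
  subst-after-unguarded ρ (P ∥ Q)    σ (∥-right u) = ∥-right (subst-after-unguarded ρ Q σ u)
  subst-after-unguarded ρ (! P)      σ (! u)       = ! subst-after-unguarded ρ P σ u
  subst-after-unguarded ρ ⦅ Ψ ⦆      σ ⦅⦆          = ⦅⦆

  subst-after-wellFormed : ∀ ρ {P} σ → WellFormed P → WellFormed (subst-after ρ P σ)
  subst-after-wellFormed ρ σ (output {M} {K} s w) =
    output (proj₂ (proj₂ (renamed-term-sort ρ K σ _)) (proj₁ (proj₂ (renamed-term-sort ρ M σ _)) s))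
           (subst-after-wellFormed ρ σ w)
  subst-after-wellFormed ρ σ (input {M} {x̃} {Y} {P} v u r w) =
    input (X-vars σ v′ fresh) (·*ᴸ-unique θ (·*ᴸ-unique ρ u))
          (X-sort σ v′ fresh _
            (subst (_ canReceive_) (sym sort-Y)
              (proj₁ (renamed-term-sort ρ M σ _) r)))
          (subst-after-wellFormed (θ ++ ρ) σ w)
    where
    others : List Name
    others = X.n (ρ X.·* Y) ++ n (ρ ·* P)
    θ : List Swapping
    θ = freshen (ρ ·*ᴸ x̃) (nˢ σ ++ ρ ·*ᴸ x̃ ++ others)
    v′ : (θ ·*ᴸ ρ ·*ᴸ x̃) ∈vars (θ X.·* ρ X.·* Y)
    v′ = ·*-vars θ (·*-vars ρ v)
    sort-Y : sortOfPattern (θ X.·* ρ X.·* Y) ≡ sortOfPattern Y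
    sort-Y = trans (·*-sortOfPattern θ _) (·*-sortOfPattern ρ Y)
    fresh : θ ·*ᴸ ρ ·*ᴸ x̃ # nˢ σ
    fresh = All.map (_∘ ∈-++⁺ˡ)
      (freshen-avoids (ρ ·*ᴸ x̃) (·*ᴸ-unique ρ u) (∈-++⁺ʳ (nˢ σ) ∘ ∈-++⁺ˡ))
  subst-after-wellFormed ρ σ (case {P = P} g w) =
    case (λ i → g i ∘ subst-after-unguarded ρ (P i) σ) (λ i → subst-after-wellFormed ρ σ (w i))
  subst-after-wellFormed ρ σ (ν {a} {P} s w) =
    ν (subst Restrictable (sym (trans (·*ᴺ-sort θ (ρ ·*ᴺ a)) (·*ᴺ-sort ρ a))) s)
      (subst-after-wellFormed (θ ++ ρ) σ w)
    where
    θ : List Swapping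
    θ = freshen (ρ ·*ᴺ a ∷ []) (nˢ σ ++ ρ ·*ᴺ a ∷ n (ρ ·* P))
  subst-after-wellFormed ρ σ (w ∥ w′) = subst-after-wellFormed ρ σ w ∥ subst-after-wellFormed ρ σ w′
  subst-after-wellFormed ρ σ (repl {P} g w) =
    repl (g ∘ subst-after-unguarded ρ P σ) (subst-after-wellFormed ρ σ w)
  subst-after-wellFormed ρ σ ⦅ Ψ ⦆ = ⦅ _ ⦆

  []-wellFormed : ∀ {P} σ → WellFormed P → WellFormed (P [ σ ])
  []-wellFormed = subst-after-wellFormed []

  -- Transitions

  -- Every entry of the tuple may be bound by a restriction.
  AllRestrictable : List Name → Set
  AllRestrictable = All (Restrictable ∘ proj₁)

  ν*-wellFormed : ∀ {ã P} → AllRestrictable ã → WellFormed P → WellFormed (ν* ã P)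
  ν*-wellFormed []       w = w
  ν*-wellFormed (r ∷ rs) w = ν r (ν*-wellFormed rs w)

  ≈ᵃ-bn : ∀ {α β} → α ≈ᵃ β → bn α ≡ bn β
  ≈ᵃ-bn (out _ _) = refl
  ≈ᵃ-bn (inp _ _) = refl
  ≈ᵃ-bn τ         = refl

  derivative-wellFormed : ∀ {Ψ P α P′} → Ψ ▷ P —[ α ]→ P′ → WellFormed P →
                          AllRestrictable (bn α) × WellFormed P′
  derivative-wellFormed (In _ _ _ _ _ _) (input _ _ _ w) = [] , []-wellFormed _ w
  derivative-wellFormed (Out _) (output _ w) = [] , w
  derivative-wellFormed (Com _ _ _ _ t t′ _ _) (w ∥ w′)
    with rs , w₁ ← derivative-wellFormed t w
       | _  , w₂ ← derivative-wellFormed t′ w′ = [] , ν*-wellFormed rs (w₁ ∥ w₂)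
  derivative-wellFormed (Com-sym _ _ _ _ t t′ _ _) (w ∥ w′)
    with _  , w₁ ← derivative-wellFormed t w
       | rs , w₂ ← derivative-wellFormed t′ w′ = [] , ν*-wellFormed rs (w₁ ∥ w₂)
  derivative-wellFormed (Par _ _ t _) (w ∥ w′)
    with rs , w₁ ← derivative-wellFormed t w = rs , w₁ ∥ w′
  derivative-wellFormed (Par-sym _ _ t _) (w ∥ w′)
    with rs , w₂ ← derivative-wellFormed t w′ = rs , w ∥ w₂
  derivative-wellFormed (Case i t _) (case _ w) = derivative-wellFormed t (w i)
  derivative-wellFormed (Rep t) (repl g w) = derivative-wellFormed t (w ∥ repl g w)
  derivative-wellFormed (Scope t _) (ν r w)
    with rs , w₁ ← derivative-wellFormed t w = rs , ν r w₁
  derivative-wellFormed (Open ã₁ _ t _ _) (ν r w)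
    with rs , w₁ ← derivative-wellFormed t w
    with rs₁ , rs₂ ← ++⁻ ã₁ rs = ++⁺ rs₁ (r ∷ rs₂) , w₁
  derivative-wellFormed (α-bn π _ t) w
    with rs , w₁ ← derivative-wellFormed t w = All.map⁺ rs , ·-wellFormed π w₁
  derivative-wellFormed (resp _ eP eα eP′ t) w
    with rs , w₁ ← derivative-wellFormed t (≡α-wellFormed⁻¹ eP w) =
      subst AllRestrictable (≈ᵃ-bn eα) rs , ≡α-wellFormed eP′ w₁

theorem2p11 : (𝒫 : SortedPsiCalculus) → let open SortedPsiCalculus 𝒫 in let open Agents 𝒫 in
    ∀ (P : Agent) → WellFormed P →
    (∀ (σ : Subst) → WellFormed (P [ σ ])) ×
    (∀ Ψ α P′ → Ψ ▷ P —[ α ]→ P′ → WellFormed P′)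
theorem2p11 𝒫 P w =
    (λ σ → []-wellFormed σ w) , (λ Ψ α P′ t → proj₂ (derivative-wellFormed t w))
  where open Preservation 𝒫
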